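{- Let $L$ be a permutation group on a finite set $\Omega$. If $L$ is intransitive and graph-restrictive, then $L$ is semiregular.
   Context: All graphs are finite, simple and connected. For a graph $\Gamma$ and a subgroup $G\le \mathrm{Aut}(\Gamma)$ acting transitively on the vertex set, with $v$ a vertex, the pair $(\Gamma,G)$ is called locally-$L$ if the permutation group induced by the vertex-stabiliser $G_v$ on the neighbourhood $\Gamma(v)$ is permutation isomorphic to $L$ (this does not depend on $v$). A permutation group $L$ is graph-restrictive if there is a constant $c(L)$ such that for every locally-$L$ pair $(\Gamma,G)$ and every vertex $v$ of $\Gamma$ one has $|G_v|\le c(L)$. A permutation group is semiregular if all its point-stabilisers are trivial. -}

module Defs where

open import Data.Nat.Base using (ℕ; suc)
open import Data.Fin.Base using (Fin)
open import Data.Bool.Base using (Bool; true; false)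
open import Data.Product.Base using (Σ; ∃; _×_; _,_)
open import Relation.Binary.PropositionalEquality using (_≡_; _≢_)
open import Relation.Nullary using (¬_)
open import Data.Fin.Permutation
  using (Permutation′; _⟨$⟩ʳ_; _≈_; id; flip; _∘ₚ_) public

record IsPermGroup {n : ℕ} (G : Permutation′ n → Set) : Set where
  field
    resp  : ∀ {σ τ} → σ ≈ τ → G σ → G τ
    has-id : G id
    closed-∘ : ∀ {σ τ} → G σ → G τ → G (σ ∘ₚ τ)
    closed-⁻¹ : ∀ {σ} → G σ → G (flip σ)

IsTransitive : {n : ℕ} → (Permutation′ n → Set) → Set
IsTransitive {n} G = ∀ (i j : Fin n) → ∃ λ σ → G σ × (σ ⟨$⟩ʳ i ≡ j)

IsSemiregular : {n : ℕ} → (Permutation′ n → Set) → Set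
IsSemiregular {n} G = ∀ σ → G σ → ∀ (i : Fin n) → σ ⟨$⟩ʳ i ≡ i → σ ≈ id

CardAtMost : {n : ℕ} → (Permutation′ n → Set) → ℕ → Set
CardAtMost {n} P c =
  ∀ (f : Fin (suc c) → Permutation′ n) → (∀ k → P (f k)) →
  ∃ λ k → ∃ λ l → k ≢ l × (f k ≈ f l)

record Graph (N : ℕ) : Set where
  field
    adj : Fin N → Fin N → Bool
    symmetric : ∀ x y → adj x y ≡ adj y x
    irreflexive : ∀ x → adj x x ≡ false

open Graph public

data Walk {N : ℕ} (Γ : Graph N) : Fin N → Fin N → Set where
  here : ∀ {x} → Walk Γ x x
  step : ∀ {x y z} → adj Γ x y ≡ true → Walk Γ y z → Walk Γ x z

IsConnected : {N : ℕ} → Graph N → Set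
IsConnected {N} Γ = ∀ (x y : Fin N) → Walk Γ x y

IsAutomorphism : {N : ℕ} → Graph N → Permutation′ N → Set
IsAutomorphism {N} Γ σ = ∀ (x y : Fin N) → adj Γ (σ ⟨$⟩ʳ x) (σ ⟨$⟩ʳ y) ≡ adj Γ x y

Stab : {N : ℕ} → (Permutation′ N → Set) → Fin N → Permutation′ N → Set
Stab G v σ = G σ × (σ ⟨$⟩ʳ v ≡ v)

IsNbhdBijection : {N m : ℕ} → Graph N → Fin N → (Fin m → Fin N) → Set
IsNbhdBijection {N} {m} Γ v φ =
  (∀ i j → φ i ≡ φ j → i ≡ j) ×
  (∀ i → adj Γ v (φ i) ≡ true) ×
  (∀ w → adj Γ v w ≡ true → ∃ λ i → φ i ≡ w)

-- The group G_v^{Γ(v)} induced by G_v on Γ(v) is permutation isomorphic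
-- to L (on Fin m): there is a bijection φ : Fin m → Γ(v) such that
-- conjugation by φ maps the set of restrictions of elements of G_v
-- onto L.
LocallyAt : {N m : ℕ} → Graph N → (Permutation′ N → Set) → Fin N →
            (Permutation′ m → Set) → Set
LocallyAt {N} {m} Γ G v L =
  Σ (Fin m → Fin N) λ φ → IsNbhdBijection Γ v φ ×
    ((∀ σ → Stab G v σ → ∃ λ τ → L τ × (∀ i → σ ⟨$⟩ʳ φ i ≡ φ (τ ⟨$⟩ʳ i))) ×
     (∀ τ → L τ → ∃ λ σ → Stab G v σ × (∀ i → σ ⟨$⟩ʳ φ i ≡ φ (τ ⟨$⟩ʳ i))))

IsLocally : {N m : ℕ} → Graph N → (Permutation′ N → Set) →
            (Permutation′ m → Set) → Set
IsLocally {N} Γ G L =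
  IsConnected Γ × IsPermGroup G × (∀ σ → G σ → IsAutomorphism Γ σ) ×
  IsTransitive G × (∀ (v : Fin N) → LocallyAt Γ G v L)

GraphRestrictive : {m : ℕ} → (Permutation′ m → Set) → Set₁
GraphRestrictive {m} L =
  ∃ λ (c : ℕ) → ∀ (N : ℕ) (Γ : Graph N) (G : Permutation′ N → Set) →
    IsLocally Γ G L → ∀ (v : Fin N) → CardAtMost (Stab G v) c

{-# OPTIONS --safe #-}
module Submission where

open import Defs
open import Data.Bool.Base using (Bool; true; false; not; _xor_; if_then_else_)
open import Data.Bool.Properties using (xor-assoc; xor-comm; xor-same; xor-identityʳ)
open import Data.Empty using (⊥-elim)
open import Data.Fin.Base
  using (Fin; zero; suc; punchOut; inject₁; opposite; funToFin; finToFun)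
open import Data.Fin.Induction using (<-weakInduction)
open import Data.Fin.Permutation using (Permutation′; permutation; _⟨$⟩ˡ_; inverseˡ; inverseʳ)
open import Data.Fin.Properties
  using (_≟_; punchOut-injective; sequence; finToFun-funToFin; *↔×; 2↔Bool;
         opposite-involutive; suc-injective; ¬∀⟶∃¬)
open import Data.Nat.Base using (ℕ; zero; suc; _*_; _^_)
open import Data.Product.Base using (Σ; ∃; _×_; _,_; proj₁; proj₂)
open import Data.Product.Function.NonDependent.Propositional using (_×-↔_)
open import Data.Sum.Base using (_⊎_; inj₁; inj₂)
open import Effect.Monad using (module RawMonad)
open import Function.Base using (_∘_)
open import Function.Bundles using (_↔_; Inverse; mk⇔; mk↔ₛ′)
open import Function.Construct.Composition using (_↔-∘_)
open import Function.Construct.Identity using (↔-id)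
open import Function.Construct.Symmetry using (↔-sym)
open import Level using (0ℓ)
open import Relation.Binary.PropositionalEquality
  using (_≡_; _≢_; refl; sym; trans; cong; cong₂; subst; module ≡-Reasoning)
open import Relation.Binary.Structures using (IsEquivalence)
open import Relation.Nullary using (¬_; Dec; yes; no; does)
open import Relation.Nullary.Decidable
  using (¬¬-excluded-middle; decidable-stable; dec-true; dec-false; does-⇔; _×-dec_; _⊎-dec_)
open import Relation.Nullary.Negation using (¬¬-Monad; contradiction)

-- Suppose some non-identity σ ∈ L fixes a point ω, put S = L_ω, and let another
-- orbit exist.  H = L × Sⁿ acts on n + 1 copies of Fin m; for each orbit k choose an
-- involution a_k normalising the subgroup H_k of H whose L-coordinate fixes the
-- representative of k.  On the orbit of ω the involution acts on H_k = Sⁿ⁺¹ by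
-- reversing the coordinates 0 , … , n; on all other orbits it fixes coordinate 0 and
-- reverses 1 , … , n.  The coset graph of ⟨H , a_k⟩ modulo H is locally L.  A subgroup
-- of H fixing every vertex has trivial coordinate 0, and since the two reversals
-- compose to a cyclic shift of the coordinates, it is trivial.  So vertex-stabilisers
-- contain the n + 1 distinct copies of σ, with n arbitrary.  Everything is finite and
-- the conclusion is decidable, so excluded middle is available under double negation.

open RawMonad (¬¬-Monad {0ℓ}) using (rawApplicative; _>>=_; pure)

-- Finite quotients under double negation.

record FiniteQuotient {T : Set} (_~_ : T → T → Set) : Set where
  field
    size : ℕ
    class : T → Fin size
    rep : Fin size → T
    class-rep : ∀ i → class (rep i) ≡ i
    sound : ∀ {s t} → s ~ t → class s ≡ class t
    exact : ∀ {s t} → class s ≡ class t → s ~ t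

  rep-class : ∀ t → rep (class t) ~ t
  rep-class t = exact (class-rep (class t))

module _ {T : Set} {_~_ : T → T → Set} (~-equiv : IsEquivalence _~_)
         {P : T → Set} where

  open IsEquivalence ~-equiv renaming (refl to ~-refl; sym to ~-sym; trans to ~-trans)

  private
    _~′_ : Σ T P → Σ T P → Set
    (s , _) ~′ (t , _) = s ~ t

  extend-along-retraction : (r : ∀ t → ∃ λ t′ → P t′ × t ~ t′) →
    FiniteQuotient _~′_ → FiniteQuotient _~_
  extend-along-retraction r Q = record
    { size = size
    ; class = class ∘ r′
    ; rep = proj₁ ∘ rep
    ; class-rep = λ i → trans (sound (~-sym (r~ (proj₁ (rep i))))) (class-rep i)
    ; sound = λ {s} {t} s~t → sound (~-trans (~-sym (r~ s)) (~-trans s~t (r~ t)))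
    ; exact = λ {s} {t} eq → ~-trans (r~ s) (~-trans (exact eq) (~-sym (r~ t)))
    }
    where
    open FiniteQuotient Q
    r′ : T → Σ T P
    r′ t = proj₁ (r t) , proj₁ (proj₂ (r t))
    r~ : ∀ t → t ~ proj₁ (r t)
    r~ t = proj₂ (proj₂ (r t))

  extend-by-class : (t₀ : T) (P? : ∀ t → P t ⊎ t₀ ~ t) → (∀ t → P t → ¬ t₀ ~ t) →
    FiniteQuotient _~′_ → FiniteQuotient _~_
  extend-by-class t₀ P? P⇒≁ Q = record
    { size = suc size
    ; class = λ t → class⁺ (P? t)
    ; rep = rep⁺
    ; class-rep = class-rep⁺
    ; sound = λ {s} {t} → sound⁺ (P? s) (P? t)
    ; exact = λ {s} {t} → exact⁺ (P? s) (P? t)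
    }
    where
    open FiniteQuotient Q
    class⁺ : ∀ {t} → P t ⊎ t₀ ~ t → Fin (suc size)
    class⁺ (inj₁ p) = suc (class (_ , p))
    class⁺ (inj₂ _) = zero
    rep⁺ : Fin (suc size) → T
    rep⁺ zero = t₀
    rep⁺ (suc i) = proj₁ (rep i)
    sound⁺ : ∀ {s t} (p : P s ⊎ t₀ ~ s) (p′ : P t ⊎ t₀ ~ t) → s ~ t → class⁺ p ≡ class⁺ p′
    sound⁺ (inj₁ p) (inj₁ p′) s~t = cong suc (sound s~t)
    sound⁺ (inj₁ p) (inj₂ q′) s~t = ⊥-elim (P⇒≁ _ p (~-trans q′ (~-sym s~t)))
    sound⁺ (inj₂ q) (inj₁ p′) s~t = ⊥-elim (P⇒≁ _ p′ (~-trans q s~t))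
    sound⁺ (inj₂ q) (inj₂ q′) s~t = refl
    exact⁺ : ∀ {s t} (p : P s ⊎ t₀ ~ s) (p′ : P t ⊎ t₀ ~ t) → class⁺ p ≡ class⁺ p′ → s ~ t
    exact⁺ (inj₁ p) (inj₁ p′) eq = exact (suc-injective eq)
    exact⁺ (inj₂ q) (inj₂ q′) eq = ~-trans (~-sym q) q′
    class-rep⁺ : ∀ i → class⁺ (P? (rep⁺ i)) ≡ i
    class-rep⁺ zero = sound⁺ (P? t₀) (inj₂ ~-refl) ~-refl
    class-rep⁺ (suc i) = trans
      (sound⁺ (P? (proj₁ (rep i))) (inj₁ (proj₂ (rep i))) ~-refl)
      (cong suc (class-rep i))

-- Induction on `K`, removing the fibre of `f` over `zero`. That fibre lies in a single class, so
-- putting it back adds one class or none, according to whether this class meets the rest. No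
-- decision procedure for the relation is assumed, hence the double negation.
finite-quotient : ∀ {K} {T : Set} {_~_ : T → T → Set} → IsEquivalence _~_ →
  (f : T → Fin K) → (∀ {s t} → f s ≡ f t → s ~ t) → ¬ ¬ FiniteQuotient _~_
finite-quotient {zero} eqv f f⇒~ ¬Q = ¬Q record
  { size = zero ; class = f ; rep = λ () ; class-rep = λ ()
  ; sound = λ {s} → no-elements (f s) ; exact = f⇒~ }
  where
  no-elements : ∀ {A : Set} → Fin zero → A
  no-elements ()
finite-quotient {suc K} {T} {_~_} eqv f f⇒~ = do
  Q ← finite-quotient {K} {Σ T P}
        (record { refl = ~-refl ; sym = ~-sym ; trans = ~-trans })
        (λ (t , 0≢ft) → punchOut 0≢ft)
        (λ {(_ , p)} {(_ , q)} eq → f⇒~ (punchOut-injective p q eq))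
  yes (t₀ , 0≡ft₀) ← ¬¬-excluded-middle {A = ∃ λ t → zero ≡ f t}
    where no ∄t₀ → pure (extend-along-retraction eqv
                      (λ t → t , (λ eq → ∄t₀ (t , eq)) , ~-refl) Q)
  yes (t₁ , 0≢ft₁ , t₀~t₁) ← ¬¬-excluded-middle {A = ∃ λ t → P t × t₀ ~ t}
    where no ∄t₁ → pure (extend-by-class eqv t₀
                      (λ t → split (λ 0≡ft → f⇒~ (trans (sym 0≡ft₀) 0≡ft)) (zero ≟ f t))
                      (λ t p t₀~t → ∄t₁ (t , p , t₀~t)) Q)
  pure (extend-along-retraction eqv
    (λ t → retract t₁ 0≢ft₁ (λ 0≡ft → ~-trans (f⇒~ (trans (sym 0≡ft) 0≡ft₀)) t₀~t₁)
             (zero ≟ f t)) Q)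
  where
  open IsEquivalence eqv renaming (refl to ~-refl; sym to ~-sym; trans to ~-trans)
  P : T → Set
  P t = zero ≢ f t
  split : ∀ {t} {A : Set} → (zero ≡ f t → A) → Dec (zero ≡ f t) → P t ⊎ A
  split g (yes eq) = inj₂ (g eq)
  split g (no neq) = inj₁ neq
  retract : ∀ {t} t₁ → P t₁ → (zero ≡ f t → t ~ t₁) → Dec (zero ≡ f t) →
            ∃ λ t′ → P t′ × t ~ t′
  retract t₁ p g (yes eq) = t₁ , p , g eq
  retract t₁ p g (no neq) = _ , neq , ~-refl

-- Generated groups, right cosets and neighbour systems.

module _ {M : ℕ} where

  data Generated (P : Permutation′ M → Set) : Permutation′ M → Set where
    gen      : ∀ {σ} → P σ → Generated P σ
    gen-resp : ∀ {σ τ} → σ ≈ τ → Generated P σ → Generated P τ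
    gen-id   : Generated P id
    gen-∘    : ∀ {σ τ} → Generated P σ → Generated P τ → Generated P (σ ∘ₚ τ)
    gen-⁻¹   : ∀ {σ} → Generated P σ → Generated P (flip σ)

  ⟨_,_⟩ : ∀ {m} → (Permutation′ M → Set) → (Fin m → Permutation′ M) → Permutation′ M → Set
  ⟨ H , β ⟩ = Generated (λ σ → H σ ⊎ ∃ λ i → β i ≈ σ)

  -- Permutations compose from left to right, so this says H x = H y.
  record SameCoset (H : Permutation′ M → Set) (x y : Permutation′ M) : Set where
    constructor same-coset
    field
      translation : Permutation′ M
      in-subgroup : H translation
      translated  : translation ∘ₚ x ≈ y

  module _ {H : Permutation′ M → Set} (H-group : IsPermGroup H) where
    open IsPermGroup H-group

    sameCoset-refl : ∀ {x y} → x ≈ y → SameCoset H x y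
    sameCoset-refl = same-coset id has-id

    sameCoset-sym : ∀ {x y} → SameCoset H x y → SameCoset H y x
    sameCoset-sym {x} (same-coset h Hh eq) = same-coset (flip h) (closed-⁻¹ Hh) λ p →
      trans (sym (eq (flip h ⟨$⟩ʳ p))) (cong (x ⟨$⟩ʳ_) (inverseʳ h))

    sameCoset-trans : ∀ {x y z} → SameCoset H x y → SameCoset H y z → SameCoset H x z
    sameCoset-trans (same-coset h Hh eq) (same-coset k Hk eq′) =
      same-coset (k ∘ₚ h) (closed-∘ Hk Hh) λ p → trans (eq (k ⟨$⟩ʳ p)) (eq′ p)

  sameCoset-∘ : ∀ {H : Permutation′ M → Set} {x y} w →
    SameCoset H x y → SameCoset H (x ∘ₚ w) (y ∘ₚ w)
  sameCoset-∘ w (same-coset h Hh eq) = same-coset h Hh λ p → cong (w ⟨$⟩ʳ_) (eq p)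

  -- The cosets H β₀ , … , H βₘ₋₁ are to be the neighbours of the vertex H in a
  -- coset graph, with H permuting them by right multiplication as L permutes Fin m.
  record IsNeighbourSystem {m : ℕ} (H : Permutation′ M → Set) (L : Permutation′ m → Set)
                           (β : Fin m → Permutation′ M) : Set where
    field
      H-group     : IsPermGroup H
      β-injective : ∀ {i j} → SameCoset H (β i) (β j) → i ≡ j
      β-outside   : ∀ i → ¬ SameCoset H (β i) id
      β-inverse   : ∀ i → ∃ λ j → H (β j ∘ₚ β i)
      induces-⊆   : ∀ h → H h → ∃ λ τ → L τ ×
                      (∀ i → SameCoset H (β i ∘ₚ h) (β (τ ⟨$⟩ʳ i)))
      induces-⊇   : ∀ τ → L τ → ∃ λ h → H h ×
                      (∀ i → SameCoset H (β i ∘ₚ h) (β (τ ⟨$⟩ʳ i)))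

-- The coset graph of a neighbour system.

walk-append : ∀ {N} {Γ : Graph N} {x y z} → Walk Γ x y → Walk Γ y z → Walk Γ x z
walk-append here q = q
walk-append (step e p) q = step e (walk-append p q)

walk-reverse : ∀ {N} {Γ : Graph N} {x y} → Walk Γ x y → Walk Γ y x
walk-reverse here = here
walk-reverse {Γ = Γ} (step {x} {y} e p) =
  walk-append (walk-reverse p) (step (trans (symmetric Γ y x) e) here)

walk-≡ : ∀ {N} {Γ : Graph N} {x y} → x ≡ y → Walk Γ x y
walk-≡ refl = here

does⇒ : ∀ {A : Set} (d : Dec A) → does d ≡ true → A
does⇒ (yes a) refl = a

module _ {M m : ℕ} {H : Permutation′ M → Set} {L : Permutation′ m → Set}
         {β : Fin m → Permutation′ M} (system : IsNeighbourSystem H L β) where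

  open IsNeighbourSystem system

  private
    W : Set
    W = Σ (Permutation′ M) ⟨ H , β ⟩

    infixl 7 _·_
    _·_ : W → W → W
    (x , p) · (y , q) = x ∘ₚ y , gen-∘ p q

    _⁻¹ : W → W
    (x , p) ⁻¹ = flip x , gen-⁻¹ p

    ⟨H⟩ : ∀ {h} → H h → W
    ⟨H⟩ Hh = _ , gen (inj₁ Hh)

    b : Fin m → W
    b i = β i , gen (inj₂ (i , λ _ → refl))

    -- A wrapper, so that `s` and `t` stay inferable although `SameCoset` sees only their first
    -- components.
    record _~_ (s t : W) : Set where
      constructor ⟪_⟫
      field unwrap : SameCoset H (proj₁ s) (proj₁ t)

    ≈⇒~ : ∀ {s t : W} → proj₁ s ≈ proj₁ t → s ~ t
    ≈⇒~ eq = ⟪ sameCoset-refl H-group eq ⟫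

    ~-sym : ∀ {s t} → s ~ t → t ~ s
    ~-sym ⟪ e ⟫ = ⟪ sameCoset-sym H-group e ⟫

    ~-trans : ∀ {s t u} → s ~ t → t ~ u → s ~ u
    ~-trans ⟪ e ⟫ ⟪ f ⟫ = ⟪ sameCoset-trans H-group e f ⟫

    ~-· : ∀ {s t} w → s ~ t → (s · w) ~ (t · w)
    ~-· w ⟪ e ⟫ = ⟪ sameCoset-∘ (proj₁ w) e ⟫

    ~-equiv : IsEquivalence _~_
    ~-equiv = record { refl = ≈⇒~ λ _ → refl ; sym = ~-sym ; trans = ~-trans }

    -- The neighbours of `H s` are the cosets `H (β i) s`, so adjacency is preserved by right
    -- multiplication.
    record E (s t : W) : Set where
      constructor _,_
      field
        label   : Fin m
        related : (b label · s) ~ t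

    -- Left multiplication by `β i` need not respect cosets. But if `t` is `h s`, then `β i h` lies
    -- in the coset of some `β j`, so only the label changes.
    b-·-~ : ∀ {s t} → s ~ t → ∀ i → ∃ λ j → (b i · t) ~ (b j · s)
    b-·-~ {s} {t} ⟪ same-coset h Hh eq ⟫ i with τ , _ , local ← induces-⊆ h Hh =
      τ ⟨$⟩ʳ i , ~-trans {t = b i · ⟨H⟩ Hh · s}
        (≈⇒~ λ p → sym (eq (β i ⟨$⟩ʳ p))) (~-· {b i · ⟨H⟩ Hh} s ⟪ local i ⟫)

    E-resp : ∀ {s s′ t t′} → s ~ s′ → t ~ t′ → E s t → E s′ t′
    E-resp s~s′ t~t′ (i , e) with j , f ← b-·-~ (~-sym s~s′) i =
      j , ~-trans (~-sym f) (~-trans e t~t′)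

    E-· : ∀ {s t} w → E s t → E (s · w) (t · w)
    E-· {s} w (i , e) = i , ~-trans (≈⇒~ λ _ → refl) (~-· {b i · s} w e)

    E-·⁻ : ∀ {s t} w → E (s · w) (t · w) → E s t
    E-·⁻ w e = E-resp (≈⇒~ λ _ → inverseˡ (proj₁ w)) (≈⇒~ λ _ → inverseˡ (proj₁ w))
      (E-· (w ⁻¹) e)

    E-sym : ∀ {s t} → E s t → E t s
    E-sym (i , e) with j , Hβjβi ← β-inverse i with k , f ← b-·-~ (~-sym e) j =
      k , ~-trans (~-sym f) (~-sym ⟪ same-coset _ Hβjβi (λ _ → refl) ⟫)

    -- Cancelling `s` on the right would put `β i` into `H`.
    E-irrefl : ∀ {s} → ¬ E s s
    E-irrefl {s} (i , e) = β-outside i (_~_.unwrap {b i} {_ , gen-id}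
      (~-trans {t = b i · s · s ⁻¹} (≈⇒~ λ _ → sym (inverseˡ (proj₁ s)))
        (~-trans (~-· (s ⁻¹) e) (≈⇒~ λ _ → inverseˡ (proj₁ s)))))

    module Quotient (Q : FiniteQuotient _~_)
                    (E? : ∀ i j → Dec (E (FiniteQuotient.rep Q i) (FiniteQuotient.rep Q j))) where
      open FiniteQuotient Q

      class-≈ : ∀ {s t : W} → proj₁ s ≈ proj₁ t → class s ≡ class t
      class-≈ eq = sound (≈⇒~ eq)

      Γ : Graph size
      Γ = record
        { adj = λ i j → does (E? i j)
        ; symmetric = λ i j → does-⇔ (mk⇔ E-sym E-sym) (E? i j) (E? j i)
        ; irreflexive = λ i → dec-false (E? i i) E-irrefl }

      E⇒adj : ∀ {s t} → E s t → adj Γ (class s) (class t) ≡ true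
      E⇒adj e = dec-true (E? _ _)
        (E-resp (~-sym (rep-class _)) (~-sym (rep-class _)) e)

      class-· : ∀ t w → class (rep (class t) · w) ≡ class (t · w)
      class-· t w = sound (~-· w (rep-class t))

      class-inverseʳ : ∀ t w → class (t · w · w ⁻¹) ≡ class t
      class-inverseʳ _ w = class-≈ λ _ → inverseˡ (proj₁ w)

      class-inverseˡ : ∀ t w → class (t · w ⁻¹ · w) ≡ class t
      class-inverseˡ _ w = class-≈ λ _ → inverseʳ (proj₁ w)

      act : W → Permutation′ size
      act w = permutation (λ i → class (rep i · w)) (λ i → class (rep i · w ⁻¹))
        (λ i → trans (class-· _ w) (trans (class-inverseˡ (rep i) w) (class-rep i)))
        (λ i → trans (class-· _ (w ⁻¹)) (trans (class-inverseʳ (rep i) w) (class-rep i)))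

      G : Permutation′ size → Set
      G σ = ∃ λ w → σ ≈ act w

      G-class : ∀ σ w → σ ≈ act w → ∀ t → σ ⟨$⟩ʳ class t ≡ class (t · w)
      G-class σ w σ≈w t = trans (σ≈w (class t)) (class-· t w)

      G-group : IsPermGroup G
      G-group = record
        { resp = λ σ≈τ (w , eq) → w , λ i → trans (sym (σ≈τ i)) (eq i)
        ; has-id = (id , gen-id) , λ i → sym (trans (class-≈ λ _ → refl) (class-rep i))
        ; closed-∘ = λ {σ} {τ} (w , eq) (w′ , eq′) → w · w′ , λ i →
            trans (cong (τ ⟨$⟩ʳ_) (eq i))
              (trans (G-class τ w′ eq′ (rep i · w)) (class-≈ λ _ → refl))
        ; closed-⁻¹ = λ {σ} (w , eq) → w ⁻¹ , λ i →
            trans (cong (flip σ ⟨$⟩ʳ_) (sym (trans (G-class σ w eq (rep i · w ⁻¹))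
                    (trans (class-inverseˡ (rep i) w) (class-rep i)))))
              (inverseˡ σ)
        }

      G-automorphisms : ∀ σ → G σ → IsAutomorphism Γ σ
      G-automorphisms σ (w , eq) i j rewrite eq i | eq j =
        does-⇔ (mk⇔ (λ e → E-·⁻ w (E-resp (rep-class _) (rep-class _) e))
                    (λ e → E-resp (~-sym (rep-class _)) (~-sym (rep-class _)) (E-· w e)))
               (E? _ _) (E? _ _)

      G-transitive : IsTransitive G
      G-transitive i j = act (rep i ⁻¹ · rep j) , (rep i ⁻¹ · rep j , λ _ → refl) ,
        trans (class-≈ λ _ → cong (proj₁ (rep j) ⟨$⟩ʳ_) (inverseˡ (proj₁ (rep i))))
              (class-rep j)

      -- A generator prefixed on the left keeps the vertex if it lies in `H` and crosses one edge if
      -- it is some `β i`. The walk follows the word for `σ` from its right end.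
      walk-to-translate : ∀ {σ} (p : ⟨ H , β ⟩ σ) t → Walk Γ (class t) (class ((σ , p) · t))
      walk-to-translate (gen (inj₁ Hh)) t = walk-≡ (sound ⟪ same-coset _ Hh (λ _ → refl) ⟫)
      walk-to-translate (gen (inj₂ (i , βi≈σ))) t =
        step (E⇒adj (i , ≈⇒~ λ q → cong (proj₁ t ⟨$⟩ʳ_) (βi≈σ q))) here
      walk-to-translate (gen-resp σ≈τ q) t = walk-append (walk-to-translate q t)
        (walk-≡ (class-≈ λ r → cong (proj₁ t ⟨$⟩ʳ_) (σ≈τ r)))
      walk-to-translate gen-id t = walk-≡ (class-≈ λ _ → refl)
      walk-to-translate (gen-∘ {σ} {τ} p q) t =
        walk-append (walk-to-translate q t)
          (walk-append (walk-to-translate p ((τ , q) · t)) (walk-≡ (class-≈ λ _ → refl)))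
      walk-to-translate (gen-⁻¹ {σ} p) t =
        walk-reverse (walk-append (walk-to-translate p ((σ , p) ⁻¹ · t))
          (walk-≡ (class-≈ λ _ → cong (proj₁ t ⟨$⟩ʳ_) (inverseˡ σ))))

      Γ-connected : IsConnected Γ
      Γ-connected i j = walk-append (walk-≡ (sym (class-rep i)))
        (walk-append (walk-to-translate (proj₂ (rep j · rep i ⁻¹)) (rep i))
          (walk-≡ (trans (class-inverseˡ (rep j) (rep i)) (class-rep j))))

      -- With `x` representing `v`, the neighbours are the cosets `H (β i) x`. An element fixing
      -- `H x` is `x⁻¹ h x` with `h` in `H`, and it sends `H (β i) x` to `H (β i) h x`; so the local
      -- action is that of `H` on labels.
      G-local : ∀ v → LocallyAt Γ G v L
      G-local v = φ , (φ-injective , φ-adjacent , φ-surjective) , induced-⊆ , induced-⊇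
        where
        x : W
        x = rep v
        φ : Fin m → Fin size
        φ i = class (b i · x)
        φ-injective : ∀ i j → φ i ≡ φ j → i ≡ j
        φ-injective i j eq = β-injective (_~_.unwrap {b i} {b j}
          (~-trans {t = b i · x · x ⁻¹} (≈⇒~ λ _ → sym (inverseˡ (proj₁ x)))
            (~-trans (~-· (x ⁻¹) (exact eq)) (≈⇒~ λ _ → inverseˡ (proj₁ x)))))
        φ-adjacent : ∀ i → adj Γ v (φ i) ≡ true
        φ-adjacent i = subst (λ u → adj Γ u (φ i) ≡ true) (class-rep v)
          (E⇒adj (i , ≈⇒~ λ _ → refl))
        φ-surjective : ∀ w → adj Γ v w ≡ true → ∃ λ i → φ i ≡ w
        φ-surjective w e with i , f ← does⇒ (E? v w) e =
          i , trans (sound f) (class-rep w)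
        φ-translate : ∀ {h} (Hh : H h) (τ : Permutation′ m) →
          (∀ i → SameCoset H (β i ∘ₚ h) (β (τ ⟨$⟩ʳ i))) →
          ∀ i → class (b i · ⟨H⟩ Hh · x) ≡ φ (τ ⟨$⟩ʳ i)
        φ-translate Hh τ local i = sound (~-· {b i · ⟨H⟩ Hh} x ⟪ local i ⟫)
        induced-⊆ : ∀ σ → Stab G v σ →
          ∃ λ τ → L τ × (∀ i → σ ⟨$⟩ʳ φ i ≡ φ (τ ⟨$⟩ʳ i))
        induced-⊆ σ ((w , eq) , fix)
          with ⟪ same-coset h Hh hx≈xw ⟫ ← exact (trans (class-rep v) (trans (sym fix) (eq v)))
          with τ , Lτ , local ← induces-⊆ h Hh =
          τ , Lτ , λ i → trans (G-class σ w eq (b i · x))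
            (trans (class-≈ λ p → sym (hx≈xw (β i ⟨$⟩ʳ p))) (φ-translate Hh τ local i))
        induced-⊇ : ∀ τ → L τ →
          ∃ λ σ → Stab G v σ × (∀ i → σ ⟨$⟩ʳ φ i ≡ φ (τ ⟨$⟩ʳ i))
        induced-⊇ τ Lτ with h , Hh , local ← induces-⊇ τ Lτ =
          act w , ((w , λ _ → refl) , fix) , λ i → trans (class-· (b i · x) w)
            (trans (class-≈ λ _ → xw≈hx) (φ-translate Hh τ local i))
          where
          w : W
          w = x ⁻¹ · (⟨H⟩ Hh · x)
          xw≈hx : ∀ {p} → proj₁ (x · w) ⟨$⟩ʳ p ≡ proj₁ (⟨H⟩ Hh · x) ⟨$⟩ʳ p
          xw≈hx = cong (λ q → proj₁ x ⟨$⟩ʳ (h ⟨$⟩ʳ q)) (inverseˡ (proj₁ x))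
          fix : class (x · w) ≡ v
          fix = trans (sym (sound ⟪ same-coset h Hh (λ _ → sym xw≈hx) ⟫)) (class-rep v)

      G-locally : IsLocally Γ G L
      G-locally = Γ-connected , G-group , G-automorphisms , G-transitive , G-local

      base : Fin size
      base = class (id , gen-id)

      act-stabilises : ∀ {h} (Hh : H h) → Stab G base (act (⟨H⟩ Hh))
      act-stabilises Hh = (⟨H⟩ Hh , λ _ → refl) ,
        trans (class-· (id , gen-id) (⟨H⟩ Hh))
          (sym (sound ⟪ same-coset _ Hh (λ _ → refl) ⟫))

      -- The action need not be faithful: equal permutations only give agreement at every vertex,
      -- that is, equality modulo the core of `H`.
      act-injective : ∀ w w′ → act w ≈ act w′ → ∀ x → (x · w) ~ (x · w′)
      act-injective w w′ eq x = exact
        (trans (sym (class-· x w)) (trans (eq (class x)) (class-· x w′)))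

    code : W → Fin (M ^ M)
    code (x , _) = funToFin (x ⟨$⟩ʳ_)

    code-injective : ∀ s t → code s ≡ code t → proj₁ s ≈ proj₁ t
    code-injective (s , _) (t , _) eq p =
      trans (sym (finToFun-funToFin (s ⟨$⟩ʳ_) p))
        (trans (cong (λ k → finToFun k p) eq) (finToFun-funToFin (t ⟨$⟩ʳ_) p))

  bounded-stabilisers⇒core : ∀ {c} →
    (∀ N (Γ : Graph N) (G : Permutation′ N → Set) → IsLocally Γ G L →
      ∀ v → CardAtMost (Stab G v) c) →
    (f : Fin (suc c) → Permutation′ M) → (∀ k → H (f k)) →
    ¬ ¬ ∃ λ k → ∃ λ l → k ≢ l ×
      (∀ x → ⟨ H , β ⟩ x → SameCoset H (x ∘ₚ f k) (x ∘ₚ f l))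
  bounded-stabilisers⇒core bound f Hf = do
    Q ← finite-quotient ~-equiv code
          (λ {s} {t} eq → ≈⇒~ (code-injective s t eq))
    -- Adjacency is decided on representatives only; these are finitely many pairs, so the decisions
    -- can be collected under the double negation.
    E? ← sequence rawApplicative λ i → sequence rawApplicative λ j → ¬¬-excluded-middle
    let open Quotient Q E?
        k , l , k≢l , eq = bound _ Γ G G-locally base
          (λ k → act (⟨H⟩ (Hf k))) (λ k → act-stabilises (Hf k))
    pure (k , l , k≢l , λ x p → 
      _~_.unwrap (act-injective (⟨H⟩ (Hf k)) (⟨H⟩ (Hf l)) eq (x , p)))

-- Orbits, reversals of the coordinates, single-coordinate families.

SameOrbit : ∀ {m} → (Permutation′ m → Set) → Fin m → Fin m → Set
SameOrbit L i j = ∃ λ τ → L τ × τ ⟨$⟩ʳ i ≡ j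

sameOrbit-equiv : ∀ {m} {L : Permutation′ m → Set} → IsPermGroup L →
  IsEquivalence (SameOrbit L)
sameOrbit-equiv L-group = record
  { refl = id , has-id , refl
  ; sym = λ (τ , Lτ , eq) → flip τ , closed-⁻¹ Lτ ,
      trans (cong (flip τ ⟨$⟩ʳ_) (sym eq)) (inverseˡ τ)
  ; trans = λ (τ , Lτ , eq) (τ′ , Lτ′ , eq′) → τ ∘ₚ τ′ , closed-∘ Lτ Lτ′ ,
      trans (cong (τ′ ⟨$⟩ʳ_) eq) eq′
  }
  where open IsPermGroup L-group

xor-cancelʳ : ∀ x y → (x xor y) xor y ≡ x
xor-cancelʳ x y = trans (xor-assoc x y y)
  (trans (cong (x xor_) (xor-same y)) (xor-identityʳ x))

-- Negation modulo `n + 1`, whereas `opposite` is `j ↦ -1 - j`. Applying `opposite` and then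
-- `negate` gives `j ↦ j + 1`.
negate : ∀ {n} → Fin (suc n) → Fin (suc n)
negate zero = zero
negate (suc i) = suc (opposite i)

negate-involutive : ∀ {n} (j : Fin (suc n)) → negate (negate j) ≡ j
negate-involutive zero = refl
negate-involutive (suc i) = cong suc (opposite-involutive i)

negate-zero : ∀ {n} (j : Fin (suc n)) → negate j ≡ zero → j ≡ zero
negate-zero zero _ = refl

negate-opposite-inject₁ : ∀ {n} (i : Fin n) → negate (opposite (inject₁ i)) ≡ suc i
negate-opposite-inject₁ i = begin
  negate (opposite (inject₁ i))
    -- `opposite (suc j)` unfolds to `inject₁ (opposite j)`, so writing `i` as a double reflection
    -- produces a second `opposite` to cancel.
    ≡⟨ cong (λ j → negate (opposite (inject₁ j))) (opposite-involutive i) ⟨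
  negate (opposite (opposite (suc (opposite i))))
    ≡⟨ cong negate (opposite-involutive (suc (opposite i))) ⟩
  suc (opposite (opposite i))
    ≡⟨ cong suc (opposite-involutive i) ⟩
  suc i ∎
  where open ≡-Reasoning

at : ∀ {m n} → Fin n → Permutation′ m → Fin n → Permutation′ m
at j τ j′ = if does (j′ ≟ j) then τ else id

at-≡ : ∀ {m n} (j : Fin n) (τ : Permutation′ m) → at j τ j ≡ τ
at-≡ j τ rewrite dec-true (j ≟ j) refl = refl

at-≢ : ∀ {m n} {j j′ : Fin n} (τ : Permutation′ m) → j′ ≢ j → at j τ j′ ≡ id
at-≢ {j = j} {j′} τ j′≢j rewrite dec-false (j′ ≟ j) j′≢j = refl

at-elim : ∀ {m n} (P : Permutation′ m → Set) (j : Fin n) {τ} → P id → P τ →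
  ∀ j′ → P (at j τ j′)
at-elim P j Pid Pτ j′ with does (j′ ≟ j)
... | true = Pτ
... | false = Pid

-- The group `H` on copies of `Fin m`.

module Construction
  {m : ℕ} {L : Permutation′ m → Set} (L-group : IsPermGroup L)
  (orbits : FiniteQuotient (SameOrbit L)) (k₁ : Fin (FiniteQuotient.size orbits))
  (n : ℕ) {M : ℕ} (e : Fin M ↔ (Fin m × Fin (suc n) × Bool))
  where

  open IsPermGroup L-group
  open FiniteQuotient orbits renaming (size to r; class to orbit)

  Point : Set
  Point = Fin m × Fin (suc n) × Bool

  enc : Point → Fin M
  enc = Inverse.from e

  enc-injective : ∀ {z z′} → enc z ≡ enc z′ → z ≡ z′
  enc-injective {z} {z′} eq = trans (sym (Inverse.strictlyInverseˡ e z))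
    (trans (cong (Inverse.to e) eq) (Inverse.strictlyInverseˡ e z′))

  enc-elim : (P : Fin M → Set) → (∀ z → P (enc z)) → ∀ p → P p
  enc-elim P Penc p = subst P (Inverse.strictlyInverseʳ e p) (Penc (Inverse.to e p))

  opaque
    transport : Point ↔ Point → Permutation′ M
    transport F = ↔-sym e ↔-∘ (F ↔-∘ e)

    transport-enc : ∀ F z → transport F ⟨$⟩ʳ enc z ≡ enc (Inverse.to F z)
    transport-enc F z = cong (λ y → enc (Inverse.to F y)) (Inverse.strictlyInverseˡ e z)

  ω : Fin m
  ω = rep k₁

  Components : Set
  Components = Fin (suc n) → Permutation′ m

  ActsBy : Permutation′ M → Components → Set
  ActsBy σ h = ∀ x j ε → σ ⟨$⟩ʳ enc (x , j , ε) ≡ enc (h j ⟨$⟩ʳ x , j , ε)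

  -- Coordinate `zero` ranges over all of `L`. The components are kept as data because coordinate
  -- `zero` is the witness for the local action.
  record H (σ : Permutation′ M) : Set where
    constructor acting
    field
      components : Components
      in-L       : ∀ j → L (components j)
      fixes-ω    : ∀ i → components (suc i) ⟨$⟩ʳ ω ≡ ω
      acts       : ActsBy σ components

  open H

  H-group : IsPermGroup H
  H-group = record
    { resp = λ σ≈τ (acting h Lh hω act) → acting h Lh hω
        λ x j ε → trans (sym (σ≈τ _)) (act x j ε)
    ; has-id = acting (λ _ → id) (λ _ → has-id) (λ _ → refl) λ _ _ _ → refl
    ; closed-∘ = λ {σ} {τ} (acting h Lh hω act) (acting h′ Lh′ h′ω act′) → acting
        (λ j → h j ∘ₚ h′ j)
        (λ j → closed-∘ (Lh j) (Lh′ j))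
        (λ i → trans (cong (h′ (suc i) ⟨$⟩ʳ_) (hω i)) (h′ω i))
        λ x j ε → trans (cong (τ ⟨$⟩ʳ_) (act x j ε)) (act′ _ j ε)
    ; closed-⁻¹ = λ {σ} (acting h Lh hω act) → acting
        (λ j → flip (h j))
        (λ j → closed-⁻¹ (Lh j))
        (λ i → trans (cong (flip (h (suc i)) ⟨$⟩ʳ_) (sym (hω i))) (inverseˡ (h (suc i))))
        λ x j ε → trans
          (cong (flip σ ⟨$⟩ʳ_) (sym (trans (act _ j ε)
            (cong (λ y → enc (y , j , ε)) (inverseʳ (h j))))))
          (inverseˡ σ)
    }

  coordinatewise : Components → Permutation′ M
  coordinatewise h = transport (mk↔ₛ′
    (λ (x , j , ε) → h j ⟨$⟩ʳ x , j , ε)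
    (λ (x , j , ε) → h j ⟨$⟩ˡ x , j , ε)
    (λ (x , j , ε) → cong (_, j , ε) (inverseʳ (h j)))
    (λ (x , j , ε) → cong (_, j , ε) (inverseˡ (h j))))

  coordinatewise-acts : ∀ h → ActsBy (coordinatewise h) h
  coordinatewise-acts h x j ε = transport-enc _ (x , j , ε)

  at-zero∈H : ∀ {τ} → L τ → H (coordinatewise (at zero τ))
  at-zero∈H {τ} Lτ = acting (at zero τ) (at-elim L zero has-id Lτ) (λ _ → refl)
    (coordinatewise-acts (at zero τ))

  at∈H : ∀ {τ} → L τ → τ ⟨$⟩ʳ ω ≡ ω → ∀ j → H (coordinatewise (at j τ))
  at∈H {τ} Lτ τω j = acting (at j τ) (at-elim L j has-id Lτ)
    (λ i → at-elim (λ τ → τ ⟨$⟩ʳ ω ≡ ω) j refl τω (suc i))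
    (coordinatewise-acts (at j τ))

  -- The involutions `a k`.

  shift′ : ∀ {k} → Dec (k ≡ k₁) → Fin (suc n) → Fin (suc n)
  shift′ (yes _) = opposite
  shift′ (no _) = negate

  shift : Fin r → Fin (suc n) → Fin (suc n)
  shift k = shift′ (k ≟ k₁)

  shift-involutive : ∀ k j → shift k (shift k j) ≡ j
  shift-involutive k j with k ≟ k₁
  ... | yes _ = opposite-involutive j
  ... | no _ = negate-involutive j

  -- Copy `shift k zero` is included along with `zero` to make the set stable under `shift k`, so
  -- that `a-step k` is an involution.
  Flips : Fin r → Fin m → Fin (suc n) → Set
  Flips k x j = x ≡ rep k × (j ≡ zero ⊎ shift k j ≡ zero)

  flips? : ∀ k x j → Dec (Flips k x j)
  flips? k x j = (x ≟ rep k) ×-dec ((j ≟ zero) ⊎-dec (shift k j ≟ zero))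

  flips : Fin r → Fin m → Fin (suc n) → Bool
  flips k x j = does (flips? k x j)

  flips-shift : ∀ k x j → flips k x (shift k j) ≡ flips k x j
  flips-shift k x j = does-⇔ (mk⇔ to from) (flips? k x (shift k j)) (flips? k x j)
    where
    to : Flips k x (shift k j) → Flips k x j
    to (eq , inj₁ z) = eq , inj₂ z
    to (eq , inj₂ z) = eq , inj₁ (trans (sym (shift-involutive k j)) z)
    from : Flips k x j → Flips k x (shift k j)
    from (eq , inj₁ z) = eq , inj₂ (trans (shift-involutive k j) z)
    from (eq , inj₂ z) = eq , inj₁ z

  -- The bit keeps the cosets H β i distinct from one another and from H.
  a-step : Fin r → Point → Point
  a-step k (x , j , ε) = x , shift k j , ε xor flips k x j

  a-step-involutive : ∀ k z → a-step k (a-step k z) ≡ z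
  a-step-involutive k (x , j , ε) = cong₂ (λ j′ ε′ → x , j′ , ε′)
    (shift-involutive k j)
    (trans (cong ((ε xor flips k x j) xor_) (flips-shift k x j)) (xor-cancelʳ ε _))

  a : Fin r → Permutation′ M
  a k = transport (mk↔ₛ′ (a-step k) (a-step k) (a-step-involutive k) (a-step-involutive k))

  a-enc : ∀ k z → a k ⟨$⟩ʳ enc z ≡ enc (a-step k z)
  a-enc k = transport-enc _

  a-involutive : ∀ k p → a k ⟨$⟩ʳ (a k ⟨$⟩ʳ p) ≡ p
  a-involutive k = enc-elim _ λ z → trans (cong (a k ⟨$⟩ʳ_) (a-enc k z))
    (trans (a-enc k (a-step k z)) (cong enc (a-step-involutive k z)))

  -- For `k₁` the representative is `ω`, which every later coordinate fixes. For other orbits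
  -- `negate` sends only `zero` to `zero`, so copy `zero` is the only one concerned.
  fixes-rep : ∀ k (h : Components) → (∀ i → h (suc i) ⟨$⟩ʳ ω ≡ ω) →
    h zero ⟨$⟩ʳ rep k ≡ rep k → ∀ j → j ≡ zero ⊎ shift k j ≡ zero → h j ⟨$⟩ʳ rep k ≡ rep k
  fixes-rep k h hω h₀ zero _ = h₀
  fixes-rep k h hω h₀ (suc i) (inj₂ z) with k ≟ k₁
  ... | yes refl = hω i
  ... | no _ with () ← negate-zero (suc i) z

  flips-invariant : ∀ k (h : Components) → (∀ i → h (suc i) ⟨$⟩ʳ ω ≡ ω) →
    h zero ⟨$⟩ʳ rep k ≡ rep k → ∀ x j → flips k (h j ⟨$⟩ʳ x) j ≡ flips k x j
  flips-invariant k h hω h₀ x j =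
    does-⇔ (mk⇔ to from) (flips? k (h j ⟨$⟩ʳ x) j) (flips? k x j)
    where
    to : Flips k (h j ⟨$⟩ʳ x) j → Flips k x j
    to (eq , near) = trans (sym (inverseˡ (h j)))
      (trans (cong (h j ⟨$⟩ˡ_) (trans eq (sym (fixes-rep k h hω h₀ j near)))) (inverseˡ (h j))) , near
    from : Flips k x j → Flips k (h j ⟨$⟩ʳ x) j
    from (eq , near) = trans (cong (h j ⟨$⟩ʳ_) eq) (fixes-rep k h hω h₀ j near) , near

  -- For other orbits `negate` permutes the later coordinates among themselves. For `k₁` coordinate
  -- `zero` may land among them, and the hypothesis on it says that it too fixes `ω`.
  shifted-fixes : ∀ k (h : Components) → (∀ i → h (suc i) ⟨$⟩ʳ ω ≡ ω) →
    h zero ⟨$⟩ʳ rep k ≡ rep k → ∀ i → h (shift k (suc i)) ⟨$⟩ʳ ω ≡ ω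
  shifted-fixes k h hω h₀ i with k ≟ k₁
  ... | no _ = hω (opposite i)
  ... | yes refl with opposite (suc i)
  ...   | zero = h₀
  ...   | suc i′ = hω i′

  -- Conjugation permutes the components by `shift k`. The two bit flips cancel because the
  -- component applied between them preserves the flipped set.
  a-normalises : ∀ k {σ} (Hσ : H σ) → components Hσ zero ⟨$⟩ʳ rep k ≡ rep k →
    H (a k ∘ₚ σ ∘ₚ a k)
  a-normalises k {σ} (acting h Lh hω act) h₀ =
    acting (λ j → h (shift k j)) (λ j → Lh (shift k j)) (shifted-fixes k h hω h₀) act′
    where
    act′ : ActsBy (a k ∘ₚ σ ∘ₚ a k) (λ j → h (shift k j))
    act′ x j ε = begin
      a k ⟨$⟩ʳ (σ ⟨$⟩ʳ (a k ⟨$⟩ʳ enc (x , j , ε)))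
        ≡⟨ cong (λ p → a k ⟨$⟩ʳ (σ ⟨$⟩ʳ p)) (a-enc k (x , j , ε)) ⟩
      a k ⟨$⟩ʳ (σ ⟨$⟩ʳ enc (x , j′ , ε xor flips k x j))
        ≡⟨ cong (a k ⟨$⟩ʳ_) (act x j′ (ε xor flips k x j)) ⟩
      a k ⟨$⟩ʳ enc (h j′ ⟨$⟩ʳ x , j′ , ε xor flips k x j)
        ≡⟨ a-enc k (h j′ ⟨$⟩ʳ x , j′ , ε xor flips k x j) ⟩
      enc (h j′ ⟨$⟩ʳ x , shift k j′ , (ε xor flips k x j) xor flips k (h j′ ⟨$⟩ʳ x) j′)
        ≡⟨ cong₂ (λ i δ → enc (h j′ ⟨$⟩ʳ x , i , δ)) (shift-involutive k j)
             (trans (cong ((ε xor flips k x j) xor_)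
               (trans (flips-invariant k h hω h₀ x j′) (flips-shift k x j)))
               (xor-cancelʳ ε _)) ⟩
      enc (h j′ ⟨$⟩ʳ x , j , ε) ∎
      where
      open ≡-Reasoning
      j′ : Fin (suc n)
      j′ = shift k j

  -- The neighbours of the vertex `H` and the local action.

  τ : Fin m → Permutation′ m
  τ i = proj₁ (rep-class i)

  Lτ : ∀ i → L (τ i)
  Lτ i = proj₁ (proj₂ (rep-class i))

  τ-rep : ∀ i → τ i ⟨$⟩ʳ rep (orbit i) ≡ i
  τ-rep i = proj₂ (proj₂ (rep-class i))

  g : Fin m → Permutation′ M
  g i = coordinatewise (at zero (τ i))

  Hg : ∀ i → H (g i)
  Hg i = at-zero∈H (Lτ i)

  -- The coset of `a k` is the neighbour labelled `rep k`; `g i` carries it to the one labelled `i`.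
  β : Fin m → Permutation′ M
  β i = a (orbit i) ∘ₚ g i

  β-enc : ∀ i x j ε → let k = orbit i in
    β i ⟨$⟩ʳ enc (x , j , ε) ≡ enc (at zero (τ i) (shift k j) ⟨$⟩ʳ x , shift k j , ε xor flips k x j)
  β-enc i x j ε = trans (cong (g i ⟨$⟩ʳ_) (a-enc (orbit i) (x , j , ε)))
    (coordinatewise-acts (at zero (τ i)) _ _ _)

  β-marked : ∀ i ε → let k = orbit i in
    β i ⟨$⟩ʳ enc (rep k , shift k zero , ε) ≡ enc (i , zero , not ε)
  β-marked i ε = begin
    β i ⟨$⟩ʳ enc (rep k , shift k zero , ε)
      ≡⟨ β-enc i _ _ ε ⟩
    enc (at zero (τ i) (shift k (shift k zero)) ⟨$⟩ʳ rep k , shift k (shift k zero) ,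
         ε xor flips k (rep k) (shift k zero))
      ≡⟨ cong₂ (λ j δ → enc (at zero (τ i) j ⟨$⟩ʳ rep k , j , δ)) (shift-involutive k zero)
           (trans (cong (ε xor_)
             (dec-true (flips? k (rep k) (shift k zero)) (refl , inj₂ (shift-involutive k zero))))
             (xor-comm ε true)) ⟩
    enc (τ i ⟨$⟩ʳ rep k , zero , not ε)
      ≡⟨ cong (λ y → enc (y , zero , not ε)) (τ-rep i) ⟩
    enc (i , zero , not ε) ∎
    where
    open ≡-Reasoning
    k : Fin r
    k = orbit i

  -- H preserves the bit and β i flips it only over the representative of the orbit of i,
  -- carrying that to i in copy 0: this recovers i from the coset H β i.
  H-β-marked : ∀ {σ} (Hσ : H σ) i ε → let k = orbit i; j = shift k zero in
    β i ⟨$⟩ʳ (σ ⟨$⟩ʳ enc (components Hσ j ⟨$⟩ˡ rep k , j , ε)) ≡ enc (i , zero , not ε)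
  H-β-marked (acting h _ _ act) i ε = trans
    (cong (β i ⟨$⟩ʳ_) (trans (act _ _ ε) (cong (λ y → enc (y , _ , ε)) (inverseʳ (h _)))))
    (β-marked i ε)

  β-injective : ∀ {i j} → SameCoset H (β i) (β j) → i ≡ j
  β-injective {i} {j} (same-coset σ Hσ eq) = begin
    i                                        ≡⟨ cong proj₁ image ⟩
    at zero (τ j) (shift l s) ⟨$⟩ʳ y         ≡⟨ cong (λ t → at zero (τ j) t ⟨$⟩ʳ y) (cong (proj₁ ∘ proj₂) image) ⟨
    τ j ⟨$⟩ʳ y                               ≡⟨ cong (τ j ⟨$⟩ʳ_) (proj₁ flipped) ⟩
    τ j ⟨$⟩ʳ rep l                           ≡⟨ τ-rep j ⟩
    j                                        ∎
    where
    open ≡-Reasoning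
    l : Fin r
    l = orbit j
    s : Fin (suc n)
    s = shift (orbit i) zero
    y : Fin m
    y = components Hσ s ⟨$⟩ˡ rep (orbit i)
    image : (i , zero , true) ≡ (at zero (τ j) (shift l s) ⟨$⟩ʳ y , shift l s , flips l y s)
    image = enc-injective (trans (sym (H-β-marked Hσ i false))
      (trans (eq (enc (y , s , false))) (β-enc j y s false)))
    flipped : Flips l y s
    flipped = does⇒ (flips? l y s) (sym (cong (proj₂ ∘ proj₂) image))

  β-outside : ∀ i → ¬ SameCoset H (β i) id
  β-outside i (same-coset σ Hσ eq)
    with () ← cong (proj₂ ∘ proj₂)
      (enc-injective (trans (sym (H-β-marked Hσ i false)) (eq (enc (_ , _ , false)))))

  -- As `g j` fixes `rep k`, its conjugate by `a k` lies in `H`. The equation `k ≡ l` is a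
  -- hypothesis so that it can be matched: `orbit (rep k)` is only propositionally `k`.
  β-inverse′ : ∀ {k l i j} → k ≡ l → τ j ⟨$⟩ʳ rep k ≡ rep k →
    H ((a k ∘ₚ g j) ∘ₚ (a l ∘ₚ g i))
  β-inverse′ {k} {i = i} {j} refl fix = resp′ (λ _ → refl)
    (closed-∘′ (a-normalises k (Hg j) fix) (Hg i))
    where open IsPermGroup H-group renaming (resp to resp′; closed-∘ to closed-∘′) using ()

  β-inverse : ∀ i → ∃ λ j → H (β j ∘ₚ β i)
  β-inverse i = rep (orbit i) , β-inverse′ {i = i} (class-rep (orbit i))
    (trans (τ-rep (rep (orbit i))) (sym (cong rep (class-rep (orbit i)))))

  -- The coordinate `zero` of `g i · u · (g i′)⁻¹` fixes `rep k`, so the conjugate of this element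
  -- by `a k` lies in `H`. That conjugate times `a k · g i′` is `a k · g i · u`.
  a-translate : ∀ {k u i i′} (Hu : H u) →
    components Hu zero ⟨$⟩ʳ (τ i ⟨$⟩ʳ rep k) ≡ τ i′ ⟨$⟩ʳ rep k →
    SameCoset H ((a k ∘ₚ g i) ∘ₚ u) (a k ∘ₚ g i′)
  a-translate {k} {u} {i} {i′} Hu eq = sameCoset-sym H-group (same-coset _
    (a-normalises k (closed-∘′ (closed-∘′ (Hg i) Hu) (closed-⁻¹′ (Hg i′)))
      (trans (cong (τ i′ ⟨$⟩ˡ_) eq) (inverseˡ (τ i′))))
    λ p → trans (cong (g i′ ⟨$⟩ʳ_) (a-involutive k _)) (inverseʳ (g i′)))
    where open IsPermGroup H-group renaming (closed-⁻¹ to closed-⁻¹′; closed-∘ to closed-∘′) using ()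

  β-translate : ∀ {u} (Hu : H u) i → SameCoset H (β i ∘ₚ u) (β (components Hu zero ⟨$⟩ʳ i))
  β-translate {u} Hu@(acting h Lh _ _) i =
    -- `i` and `i′` lie in one orbit, so `β` uses the same involution for both.
    subst (λ k → SameCoset H (β i ∘ₚ u) (a k ∘ₚ g i′)) same-orbit
      (a-translate Hu (trans (cong (h zero ⟨$⟩ʳ_) (τ-rep i))
        (sym (trans (cong (λ k → τ i′ ⟨$⟩ʳ rep k) same-orbit) (τ-rep i′)))))
    where
    i′ : Fin m
    i′ = h zero ⟨$⟩ʳ i
    same-orbit : orbit i ≡ orbit i′
    same-orbit = sound (h zero , Lh zero , refl)

  system : IsNeighbourSystem H L β
  system = record
    { H-group = H-group
    ; β-injective = β-injective
    ; β-outside = β-outside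
    ; β-inverse = β-inverse
    ; induces-⊆ = λ u Hu → components Hu zero , in-L Hu zero , β-translate Hu
    ; induces-⊇ = λ τ Lτ → _ , at-zero∈H Lτ , β-translate (at-zero∈H Lτ)
    }

  -- Triviality of the core of `H`.

  a∈W : ∀ k → ⟨ H , β ⟩ (a k)
  a∈W k = subst (λ l → ⟨ H , β ⟩ (a l)) (class-rep k)
    (gen-resp {σ = β i ∘ₚ flip (g i)} (λ _ → inverseˡ (g i))
      (gen-∘ {σ = β i} {flip (g i)} (gen (inj₂ (i , λ _ → refl))) (gen-⁻¹ (gen (inj₁ (Hg i))))))
    where
    i : Fin m
    i = rep k

  -- The normal core of `H` in the generated group: the elements fixing every vertex of the coset
  -- graph.
  record Core (u : Permutation′ M) : Set where
    constructor core
    field conjugates-in-H : ∀ x → ⟨ H , β ⟩ x → H (x ∘ₚ u ∘ₚ flip x)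

  core-conjugate : ∀ {u w} → ⟨ H , β ⟩ w → Core u → Core (w ∘ₚ u ∘ₚ flip w)
  core-conjugate {u} {w} Ww (core Cu) = core λ x Wx →
    IsPermGroup.resp H-group (λ _ → refl) (Cu (x ∘ₚ w) (gen-∘ Wx Ww))

  core⇒H : ∀ {u} → Core u → H u
  core⇒H (core Cu) = IsPermGroup.resp H-group (λ _ → refl) (Cu id gen-id)

  fixes-neighbours : ∀ {u} (Hu : H u) i →
    SameCoset H (β i) (β i ∘ₚ u) → components Hu zero ⟨$⟩ʳ i ≡ i
  fixes-neighbours {u} Hu i fix = sym (β-injective {i} {i′}
    (sameCoset-trans H-group {β i} {β i ∘ₚ u} {β i′} fix (β-translate {u} Hu i)))
    where
    i′ : Fin m
    i′ = components Hu zero ⟨$⟩ʳ i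

  core-fixes-neighbours : ∀ {u} → Core u → ∀ i → SameCoset H (β i) (β i ∘ₚ u)
  core-fixes-neighbours {u} (core Cu) i = same-coset (β i ∘ₚ u ∘ₚ flip (β i))
    (Cu (β i) (gen (inj₂ (i , λ _ → refl)))) λ _ → inverseʳ (β i)

  module _ {k₂ : Fin r} (k₂≢k₁ : k₂ ≢ k₁) where

    shift-k₁ : ∀ j → shift k₁ j ≡ opposite j
    shift-k₁ j with k₁ ≟ k₁
    ... | yes _ = refl
    ... | no k₁≢k₁ = contradiction refl k₁≢k₁

    shift-k₂ : ∀ j → shift k₂ j ≡ negate j
    shift-k₂ j with k₂ ≟ k₁
    ... | yes eq = contradiction eq k₂≢k₁
    ... | no _ = refl

    rotation : Permutation′ M
    rotation = a k₁ ∘ₚ a k₂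

    rotation-enc : ∀ x i ε → ∃ λ δ →
      rotation ⟨$⟩ʳ enc (x , inject₁ i , ε) ≡ enc (x , suc i , δ)
    rotation-enc x i ε = δ , trans (cong (a k₂ ⟨$⟩ʳ_) (a-enc k₁ z))
      (trans (a-enc k₂ (a-step k₁ z)) (cong (λ j → enc (x , j , δ)) (trans (shift-k₂ _)
        (trans (cong negate (shift-k₁ (inject₁ i))) (negate-opposite-inject₁ i)))))
      where
      z : Point
      z = x , inject₁ i , ε
      δ : Bool
      δ = proj₂ (proj₂ (a-step k₂ (a-step k₁ z)))

    FixesCopy : Fin (suc n) → Permutation′ M → Set
    FixesCopy j u = ∀ x ε → u ⟨$⟩ʳ enc (x , j , ε) ≡ enc (x , j , ε)

    fixes-zero : ∀ {u} → Core u → H u → FixesCopy zero u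
    fixes-zero {u} Cu Hu@(acting _ _ _ act) x ε = trans (act x zero ε)
      (cong (λ y → enc (y , zero , ε)) (fixes-neighbours Hu x (core-fixes-neighbours Cu x)))

    fixes-suc : ∀ i {u} → H u → FixesCopy (inject₁ i) (rotation ∘ₚ u ∘ₚ flip rotation) →
      FixesCopy (suc i) u
    fixes-suc i {u} (acting h _ _ act) fix x ε = trans (act x (suc i) ε)
      -- How `u` moves `x` in copy `suc i` does not depend on the bit, so it is tested at `δ`, the
      -- bit that `rotation` produces, instead of `ε`.
      (cong (λ y → enc (y , suc i , ε)) (cong proj₁ (enc-injective (begin
        enc (h (suc i) ⟨$⟩ʳ x , suc i , δ)  ≡⟨ act x (suc i) δ ⟨
        u ⟨$⟩ʳ enc (x , suc i , δ)          ≡⟨ cong (u ⟨$⟩ʳ_) moved ⟨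
        u ⟨$⟩ʳ (rotation ⟨$⟩ʳ p)            ≡⟨ inverseʳ rotation ⟨
        rotation ⟨$⟩ʳ (rotation ⟨$⟩ˡ (u ⟨$⟩ʳ (rotation ⟨$⟩ʳ p)))
                                            ≡⟨ cong (rotation ⟨$⟩ʳ_) (fix x false) ⟩
        rotation ⟨$⟩ʳ p                     ≡⟨ moved ⟩
        enc (x , suc i , δ)                 ∎))))
      where
      open ≡-Reasoning
      p : Fin M
      p = enc (x , inject₁ i , false)
      δ : Bool
      δ = proj₁ (rotation-enc x i false)
      moved : rotation ⟨$⟩ʳ p ≡ enc (x , suc i , δ)
      moved = proj₂ (rotation-enc x i false)

    -- The core is normal, so the conjugate of `u` by `rotation` is again in it, and what it does on
    -- copy `i` is what `u` does on copy `i + 1`. Hence `u` is quantified inside the induction.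
    core-fixes : ∀ j {u} → Core u → FixesCopy j u
    core-fixes = <-weakInduction (λ j → ∀ {u} → Core u → FixesCopy j u)
      (λ Cu → fixes-zero Cu (core⇒H Cu))
      (λ i IH Cu → fixes-suc i (core⇒H Cu)
        (IH (core-conjugate (gen-∘ (a∈W k₁) (a∈W k₂)) Cu)))

  -- Unbounded vertex-stabilisers.

  same-action⇒core : ∀ {u v} →
    (∀ x → ⟨ H , β ⟩ x → SameCoset H (x ∘ₚ u) (x ∘ₚ v)) → Core (u ∘ₚ flip v)
  same-action⇒core {u} {v} same = core λ x Wx → conjugate x (same x Wx)
    where
    conjugate : ∀ x → SameCoset H (x ∘ₚ u) (x ∘ₚ v) → H (x ∘ₚ (u ∘ₚ flip v) ∘ₚ flip x)
    -- From `h x u = x v` the conjugate in question is `h⁻¹`.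
    conjugate x (same-coset h Hh eq) = IsPermGroup.resp H-group
      (λ p → sym (trans
        (cong (λ q → x ⟨$⟩ˡ (v ⟨$⟩ˡ q))
          (trans (cong (λ q → u ⟨$⟩ʳ (x ⟨$⟩ʳ q)) (sym (inverseʳ h))) (eq (h ⟨$⟩ˡ p))))
        (trans (cong (x ⟨$⟩ˡ_) (inverseˡ v)) (inverseˡ x))))
      (IsPermGroup.closed-⁻¹ H-group Hh)

  -- Two of the `n + 1` copies of `σ` would act alike, hence differ by a core element, which moves
  -- no point. But on copy `k` one acts as `σ` and the other as the identity.
  unbounded : ∀ {k₂ σ y} → k₂ ≢ k₁ → L σ → σ ⟨$⟩ʳ ω ≡ ω → σ ⟨$⟩ʳ y ≢ y →
    ¬ (∀ N (Γ : Graph N) (G : Permutation′ N → Set) → IsLocally Γ G L →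
        ∀ v → CardAtMost (Stab G v) n)
  unbounded {σ = σ} {y} k₂≢k₁ Lσ σω σy≢y bound =
    bounded-stabilisers⇒core system bound f (at∈H Lσ σω) λ (k , l , k≢l , same) →
      σy≢y (cong proj₁ (enc-injective (moved k l k≢l (same-action⇒core {f k} {f l} same))))
    where
    f : Fin (suc n) → Permutation′ M
    f k = coordinatewise (at k σ)
    open ≡-Reasoning
    moved : ∀ k l → k ≢ l → Core (f k ∘ₚ flip (f l)) →
      enc (σ ⟨$⟩ʳ y , k , false) ≡ enc (y , k , false)
    moved k l k≢l C = begin
      enc (σ ⟨$⟩ʳ y , k , false)
        ≡⟨ cong (λ τ → enc (τ ⟨$⟩ʳ y , k , false)) (at-≡ k σ) ⟨
      enc (at k σ k ⟨$⟩ʳ y , k , false)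
        ≡⟨ coordinatewise-acts (at k σ) y k false ⟨
      f k ⟨$⟩ʳ enc (y , k , false)
        ≡⟨ inverseʳ (f l) ⟨
      f l ⟨$⟩ʳ ((f k ∘ₚ flip (f l)) ⟨$⟩ʳ enc (y , k , false))
        ≡⟨ cong (f l ⟨$⟩ʳ_) (core-fixes k₂≢k₁ k C y false) ⟩
      f l ⟨$⟩ʳ enc (y , k , false)
        ≡⟨ coordinatewise-acts (at l σ) y k false ⟩
      enc (at l σ k ⟨$⟩ʳ y , k , false)
        ≡⟨ cong (λ τ → enc (τ ⟨$⟩ʳ y , k , false)) (at-≢ σ k≢l) ⟩
      enc (y , k , false) ∎

-- Passage to orbit representatives and the contradiction.

theorem1p2 : ∀ (m : ℕ) (L : Permutation′ m → Set) → IsPermGroup L →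
    ¬ IsTransitive L → GraphRestrictive L → IsSemiregular L
theorem1p2 m L L-group ¬transitive (c , bound) σ Lσ i σi≡i j =
  -- Equality in `Fin m` is decidable, which discharges the double negation.
  decidable-stable (σ ⟨$⟩ʳ j ≟ j) λ σj≢j →
    finite-quotient (sameOrbit-equiv L-group) (λ x → x) (λ {refl → sameOrbit-refl}) (contra σj≢j)
  where
  open IsPermGroup L-group
  sameOrbit-refl : ∀ {x} → SameOrbit L x x
  sameOrbit-refl = IsEquivalence.refl (sameOrbit-equiv L-group)

  contra : σ ⟨$⟩ʳ j ≢ j → ¬ FiniteQuotient (SameOrbit L)
  contra σj≢j orbits with ρ , Lρ , ρω≡i ← FiniteQuotient.rep-class orbits i =
    -- Taking `n = c` gives `c + 1` copies, one more than the bound. Conjugation by `ρ` replaces the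
    -- fixed point `i` by the representative of its orbit, whose stabiliser enters `H`.
    Construction.unbounded L-group orbits (class i) c points (proj₂ other-orbit)
      (closed-∘ Lρ (closed-∘ Lσ (closed-⁻¹ Lρ))) fixes moves bound
    where
    open FiniteQuotient orbits
    points : Fin (m * (suc c * 2)) ↔ (Fin m × Fin (suc c) × Bool)
    points = (↔-id _ ×-↔ ((↔-id _ ×-↔ 2↔Bool) ↔-∘ *↔×)) ↔-∘ *↔×
    other-orbit : ∃ λ x → class x ≢ class i
    other-orbit = ¬∀⟶∃¬ m (λ x → class x ≡ class i) (λ x → class x ≟ class i)
      λ one-orbit → ¬transitive λ x y → exact (trans (one-orbit x) (sym (one-orbit y)))
    fixes : ρ ⟨$⟩ˡ (σ ⟨$⟩ʳ (ρ ⟨$⟩ʳ rep (class i))) ≡ rep (class i)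
    fixes = trans (cong (λ x → ρ ⟨$⟩ˡ (σ ⟨$⟩ʳ x)) ρω≡i)
      (trans (cong (ρ ⟨$⟩ˡ_) (trans σi≡i (sym ρω≡i))) (inverseˡ ρ))
    moves : ρ ⟨$⟩ˡ (σ ⟨$⟩ʳ (ρ ⟨$⟩ʳ (ρ ⟨$⟩ˡ j))) ≢ ρ ⟨$⟩ˡ j
    moves eq = σj≢j (begin
      σ ⟨$⟩ʳ j                                          ≡⟨ cong (σ ⟨$⟩ʳ_) (inverseʳ ρ) ⟨
      σ ⟨$⟩ʳ (ρ ⟨$⟩ʳ (ρ ⟨$⟩ˡ j))                        ≡⟨ inverseʳ ρ ⟨
      ρ ⟨$⟩ʳ (ρ ⟨$⟩ˡ (σ ⟨$⟩ʳ (ρ ⟨$⟩ʳ (ρ ⟨$⟩ˡ j))))      ≡⟨ cong (ρ ⟨$⟩ʳ_) eq ⟩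
      ρ ⟨$⟩ʳ (ρ ⟨$⟩ˡ j)                                 ≡⟨ inverseʳ ρ ⟩
      j ∎)
      where open ≡-Reasoning
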